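{- Let $q$ be an odd prime power, $n$ a positive integer, and $f(x,y,z)=x+yz$ viewed as a function from $M_n(\mathbb{F}_q)^3$ to $M_n(\mathbb{F}_q)$. There are constants $C_0,c>0$ (independent of $q$ and the sets) such that for all $A,B,C\subset M_n(\mathbb{F}_q)$ with $|A||B||C|\ge C_0\, q^{3n^2-1}$ we have $|f(A,B,C)|\ge c\, q^{n^2}$.
   Context: $M_n(\mathbb{F}_q)$ is the ring of $n\times n$ matrices over $\mathbb{F}_q$, and $f(A,B,C)=\{a+bc: a\in A,b\in B,c\in C\}$. -}

module Defs where

open import Level using (0ℓ)
open import Data.Nat as ℕ using (ℕ; zero; suc; _^_; _%_)
open import Data.Nat.Primality using (Prime)
open import Data.Fin using (Fin; zero; suc)
open import Data.Product using (Σ; ∃; _×_; _,_)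
open import Data.List using (List; length)
open import Data.List.Relation.Unary.All using (All)
open import Data.Integer using (+_)
open import Data.Rational using (ℚ; _/_)
open import Algebra.Bundles using (CommutativeRing)
open import Relation.Nullary using (¬_)
open import Relation.Binary.Bundles using (Setoid)
open import Relation.Binary.PropositionalEquality as ≡ using (_≡_)
open import Function.Bundles using (Inverse)
import Data.List.Relation.Unary.Unique.Setoid as UniqueS
import Data.List.Membership.Setoid as MemS

toℚ : ℕ → ℚ
toℚ n = (+ n) / 1

IsPrimePower : ℕ → Set
IsPrimePower q = Σ ℕ λ p → Σ ℕ λ k → Prime p × (1 ℕ.≤ k) × (q ≡ p ^ k)

Odd : ℕ → Set
Odd q = q % 2 ≡ 1

record FiniteField (q : ℕ) : Set₁ where
  field
    commRing : CommutativeRing 0ℓ 0ℓ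
  open CommutativeRing commRing public
  field
    1≉0     : ¬ (1# ≈ 0#)
    inverse : ∀ x → ¬ (x ≈ 0#) → Σ Carrier λ y → (x * y) ≈ 1#
    enum    : Inverse (≡.setoid (Fin q)) setoid

module Matrices {q : ℕ} (F : FiniteField q) where
  open FiniteField F using (Carrier; _≈_; _+_; _*_; 0#; refl; sym; trans)

  Mat : ℕ → Set
  Mat n = Fin n → Fin n → Carrier

  _≈M_ : ∀ {n} → Mat n → Mat n → Set
  M ≈M N = ∀ i j → M i j ≈ N i j

  MatSetoid : ℕ → Setoid 0ℓ 0ℓ
  MatSetoid n = record
    { Carrier = Mat n
    ; _≈_ = _≈M_
    ; isEquivalence = record
      { refl = λ i j → refl
      ; sym = λ p i j → sym (p i j)
      ; trans = λ p r i j → trans (p i j) (r i j) } }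

  sumF : ∀ {n} → (Fin n → Carrier) → Carrier
  sumF {zero} g = 0#
  sumF {suc n} g = g zero + sumF (λ i → g (suc i))

  _+M_ : ∀ {n} → Mat n → Mat n → Mat n
  (M +M N) i j = M i j + N i j

  _*M_ : ∀ {n} → Mat n → Mat n → Mat n
  (M *M N) i j = sumF (λ k → M i k * N k j)

  f : ∀ {n} → Mat n → Mat n → Mat n → Mat n
  f x y z = x +M (y *M z)

  record MatSet (n : ℕ) : Set where
    field
      elems  : List (Mat n)
      unique : UniqueS.Unique (MatSetoid n) elems

  ∣_∣ : ∀ {n} → MatSet n → ℕ
  ∣ S ∣ = length (MatSet.elems S)

  _∈S_ : ∀ {n} → Mat n → MatSet n → Set
  x ∈S S = MemS._∈_ (MatSetoid _) x (MatSet.elems S)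

  InImage : ∀ {n} → MatSet n → MatSet n → MatSet n → Mat n → Set
  InImage A B C x =
    Σ _ λ a → Σ _ λ b → Σ _ λ c → a ∈S A × b ∈S B × c ∈S C × (x ≈M f a b c)

  ImageCardGE : ∀ {n} → MatSet n → MatSet n → MatSet n → ℚ → Set
  ImageCardGE {n} A B C k =
    Σ (List (Mat n)) λ L → UniqueS.Unique (MatSetoid n) L
      × All (InImage A B C) L × Data.Rational._≤_ k (toℚ (length L))

{-# OPTIONS --safe #-}
module Submission where

-- View A × B as a family of T = |A||B| "lines" {(x , a + b x)} in the plane of pairs of matrices,
-- let Q = q^(n²), and let r(x , y) be the number of lines through (x , y). Two lines whose slopes
-- differ by an invertible matrix meet in at most one point. For a given line, the lines whose slope
-- differs from its slope by one of the S singular matrices meet it at most S Q times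
-- altogether, since at each x the slope determines the translate. Hence Σ r² ≤ T² + T S Q, while
-- Σ r = T Q. No line passes through C × (complement of the image), so Chebyshev's inequality bounds
-- the size of that set by S Q³ / T. As a singular matrix kills a vector having some coordinate 1,
-- S ≤ n q^(n² - 1); so if the image had fewer than Q / 2 elements, then
-- |A||B||C| ≤ 2 S Q² ≤ 2 n q^(3n² - 1).

open import Defs
open import Level using (Level; 0ℓ)
open import Data.Fin using (Fin; zero; suc)
open import Data.Fin.Properties as Fin using (all?; ¬∀⟶∃¬)
open import Data.List using (List; []; _∷_; _++_; map; length; filter; tabulate; allFin;
  cartesianProduct; cartesianProductWith)
open import Data.List.Membership.Setoid using (_∈_)
import Data.List.Membership.Setoid.Properties as Membership
open import Data.List.Properties using (length-map; length-++; length-tabulate)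
open import Data.List.Relation.Unary.All using ([]; _∷_)
open import Data.List.Relation.Unary.AllPairs using ([]; _∷_)
open import Data.List.Relation.Unary.Any as Any using (Any; here; there)
open import Data.List.Relation.Unary.Unique.Setoid using (Unique)
import Data.List.Relation.Unary.Unique.Setoid.Properties as Uniqueness
open import Data.Nat as ℕ using (ℕ; zero; suc; _^_)
import Data.Nat.Properties as ℕ
open import Data.Product using (Σ; _×_; _,_; proj₁; proj₂)
open import Data.Product.Relation.Binary.Pointwise.NonDependent using (×-setoid)
open import Data.Vec.Functional as Vector using (Vector; insertAt; removeAt)
open import Data.Vec.Functional.Properties using (insertAt-removeAt)
open import Data.Vec.Functional.Relation.Binary.Equality.Setoid using (≋-setoid)
import Data.Vec.Functional.Relation.Binary.Pointwise.Properties as Pointwise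
open import Function using (_∘_; id)
open import Function.Bundles using (Inverse)
open import Relation.Binary.Bundles using (Setoid; DecSetoid)
open import Relation.Binary.PropositionalEquality as ≡ using (_≡_; cong; cong₂; subst; subst₂)
open import Relation.Nullary using (¬_)
open import Relation.Nullary.Decidable using (map′)

-- Finite fields and singular matrices

length-cartesianProductWith : {X Y Z : Set} (f : X → Y → Z) (xs : List X) (ys : List Y) →
  length (cartesianProductWith f xs ys) ≡ length xs ℕ.* length ys
length-cartesianProductWith f []       ys = ≡.refl
length-cartesianProductWith f (x ∷ xs) ys = ≡.trans (length-++ (map (f x) ys))
  (cong₂ ℕ._+_ (length-map (f x) ys) (length-cartesianProductWith f xs ys))

vectors : {X : Set} → List X → ∀ n → List (Vector X n)
vectors xs zero    = Vector.[] ∷ []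
vectors xs (suc n) = cartesianProductWith Vector._∷_ xs (vectors xs n)

length-vectors : {X : Set} (xs : List X) (n : ℕ) → length (vectors xs n) ≡ length xs ^ n
length-vectors xs zero    = ≡.refl
length-vectors xs (suc n) = ≡.trans (length-cartesianProductWith Vector._∷_ xs (vectors xs n))
  (cong (length xs ℕ.*_) (length-vectors xs n))

module _ (S : Setoid 0ℓ 0ℓ) where
  open Setoid S

  ∷-cong : ∀ {n x y} {u v : Vector Carrier n} → x ≈ y → (∀ i → u i ≈ v i) →
           ∀ i → (x Vector.∷ u) i ≈ (y Vector.∷ v) i
  ∷-cong x≈y u≋v zero    = x≈y
  ∷-cong x≈y u≋v (suc i) = u≋v i

  vectors-unique : ∀ {xs} → Unique S xs → ∀ n → Unique (≋-setoid S n) (vectors xs n)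
  vectors-unique xs! zero    = [] ∷ []
  vectors-unique xs! (suc n) = Uniqueness.cartesianProductWith⁺ S (≋-setoid S n) (≋-setoid S (suc n))
    Vector._∷_ (λ eq → eq zero , eq ∘ suc) xs! (vectors-unique xs! n)

  ∈-vectors : ∀ {xs} → (∀ x → _∈_ S x xs) → ∀ n v → _∈_ (≋-setoid S n) v (vectors xs n)
  ∈-vectors all zero    v = here (λ ())
  -- Without function extensionality, `v` agrees only pointwise with the vector rebuilt from its
  -- head and tail.
  ∈-vectors all (suc n) v = Membership.∈-resp-≈ (≋-setoid S (suc n))
    (λ where zero → refl ; (suc i) → refl)
    (Membership.∈-cartesianProductWith⁺ S (≋-setoid S n) (≋-setoid S (suc n)) ∷-cong
      (all (v zero)) (∈-vectors all n (v ∘ suc)))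

  insertAt-cong : ∀ {n} {u v : Vector Carrier n} {x y} (j : Fin (suc n)) →
                  (∀ i → u i ≈ v i) → x ≈ y → ∀ i → insertAt u j x i ≈ insertAt v j y i
  insertAt-cong {zero}  zero    u≋v x≈y zero    = x≈y
  insertAt-cong {suc n} zero    u≋v x≈y zero    = x≈y
  insertAt-cong {suc n} zero    u≋v x≈y (suc i) = u≋v i
  insertAt-cong {suc n} (suc j) u≋v x≈y zero    = u≋v zero
  insertAt-cong {suc n} (suc j) u≋v x≈y (suc i) = insertAt-cong j (u≋v ∘ suc) x≈y i

module FieldCounting {q : ℕ} (F : FiniteField q) where
  open FiniteField F
  open Inverse enum using (to; from; from-cong; strictlyInverseˡ; strictlyInverseʳ)
  open Matrices F
  open import Algebra.Properties.Ring ring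
    using (+-cancelˡ; +-cancelʳ; xyx⁻¹≈y; x∙y⁻¹≈ε⇒x≈y; +-inverseˡ-unique)
  open import Algebra.Properties.Semiring.Sum semiring
    using (sum; sum-cong-≋; sum-remove; *-distribʳ-sum) renaming (∑-distrib-+ to sum-distrib-+)
  open import Relation.Binary.Reasoning.Setoid setoid

  to-from : ∀ x → to (from x) ≈ x
  to-from = strictlyInverseˡ

  from-injective : ∀ {x y} → from x ≡ from y → x ≈ y
  from-injective {x} {y} eq =
    trans (sym (to-from x)) (trans (reflexive (cong to eq)) (to-from y))

  -- The equality of the field is abstract; comparing indices under `enum` decides it.
  fieldDecSetoid : DecSetoid 0ℓ 0ℓ
  fieldDecSetoid = record
    { isDecEquivalence = record
      { isEquivalence = isEquivalence
      ; _≟_ = λ x y → map′ from-injective from-cong (from x Fin.≟ from y) } }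

  elements : List Carrier
  elements = tabulate to

  length-elements : length elements ≡ q
  length-elements = length-tabulate to

  elements-unique : Unique setoid elements
  elements-unique = Uniqueness.tabulate⁺ setoid λ {i} {j} eq →
    ≡.trans (≡.sym (strictlyInverseʳ i)) (≡.trans (from-cong eq) (strictlyInverseʳ j))

  ∈-elements : ∀ x → _∈_ setoid x elements
  ∈-elements x = Membership.∈-resp-≈ setoid (to-from x) (Membership.∈-tabulate⁺ setoid (from x))

  matDecSetoid : ℕ → DecSetoid 0ℓ 0ℓ
  matDecSetoid n = record
    { isDecEquivalence = record
      { isEquivalence = Setoid.isEquivalence (MatSetoid n)
      ; _≟_ = DecSetoid._≟_ (Pointwise.decSetoid (Pointwise.decSetoid fieldDecSetoid n) n) } }

  -- Rectangular shapes are allowed because `singular` draws on the (k + 1) × k matrices left after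
  -- deleting a column.
  matrices : ∀ m n → List (Vector (Vector Carrier n) m)
  matrices m n = vectors (vectors elements n) m

  length-matrices : ∀ m n → length (matrices m n) ≡ (q ^ n) ^ m
  length-matrices m n = ≡.trans (length-vectors _ m)
    (cong (_^ m) (≡.trans (length-vectors _ n) (cong (_^ n) length-elements)))

  matrices-unique : ∀ n → Unique (MatSetoid n) (matrices n n)
  matrices-unique n = vectors-unique (≋-setoid setoid n) (vectors-unique setoid elements-unique n) n

  ∈-matrices : ∀ n M → _∈_ (MatSetoid n) M (matrices n n)
  ∈-matrices n = ∈-vectors (≋-setoid setoid n) (∈-vectors setoid ∈-elements n) n

  -- Dot products and common points of two lines

  dot : ∀ {n} → Vector Carrier n → Vector Carrier n → Carrier
  dot u v = sum λ k → u k * v k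

  sumF≈sum : ∀ n (g : Fin n → Carrier) → sumF g ≈ sum g
  sumF≈sum zero    g = refl
  sumF≈sum (suc n) g = +-congˡ (sumF≈sum n (g ∘ suc))

  col : ∀ {m n} → Vector (Vector Carrier n) m → Fin n → Vector Carrier m
  col M j i = M i j

  *M≈dot : ∀ {n} (M N : Mat n) i j → (M *M N) i j ≈ dot (M i) (col N j)
  *M≈dot {n} M N i j = sumF≈sum n _

  dot-cong : ∀ {n} {u u′ v v′ : Vector Carrier n} → (∀ i → u i ≈ u′ i) → (∀ i → v i ≈ v′ i) →
             dot u v ≈ dot u′ v′
  dot-cong u≋u′ v≋v′ = sum-cong-≋ λ k → *-cong (u≋u′ k) (v≋v′ k)

  dot-+ˡ : ∀ {n} (u v w : Vector Carrier n) → dot (λ k → u k + v k) w ≈ dot u w + dot v w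
  dot-+ˡ {n} u v w = trans (sum-cong-≋ λ k → distribʳ (w k) (u k) (v k))
    (sum-distrib-+ {n} (λ k → u k * w k) (λ k → v k * w k))

  dot-+ʳ : ∀ {n} (u v w : Vector Carrier n) → dot u (λ k → v k + w k) ≈ dot u v + dot u w
  dot-+ʳ {n} u v w = trans (sum-cong-≋ λ k → distribˡ (u k) (v k) (w k))
    (sum-distrib-+ {n} (λ k → u k * v k) (λ k → u k * w k))

  dot-*ʳ : ∀ {n} (u v : Vector Carrier n) c → dot u (λ k → v k * c) ≈ dot u v * c
  dot-*ʳ {n} u v c = trans (sum-cong-≋ λ k → sym (*-assoc (u k) (v k) c))
    (sym (*-distribʳ-sum {n} c (λ k → u k * v k)))

  y+[x-y]≈x : ∀ x y → y + (x - y) ≈ x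
  y+[x-y]≈x x y = trans (sym (+-assoc y x (- y))) (xyx⁻¹≈y y x)

  f-cong : ∀ {n} (a b : Mat n) {x y} → x ≈M y → f a b x ≈M f a b y
  f-cong a b {x} {y} x≈y i j = +-congˡ (trans (*M≈dot b x i j)
    (trans (dot-cong (λ _ → refl) (λ k → x≈y k j)) (sym (*M≈dot b y i j))))

  -- Cancelling b x shows that parallel lines are disjoint: slope and one point determine the
  -- translate.
  f-cancel : ∀ {n} {a a′ b x : Mat n} → f a b x ≈M f a′ b x → a ≈M a′
  f-cancel eq i j = +-cancelʳ _ _ _ (eq i j)

  -- Subtracting the two equations gives (b′ - b) x = a - a′ = (b′ - b) x′, so b′ - b kills every
  -- column of x - x′.
  difference-kernel : ∀ {n} (a b a′ b′ x x′ : Mat n) →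
    f a b x ≈M f a′ b′ x → f a b x′ ≈M f a′ b′ x′ →
    ∀ i j → dot (λ k → b′ i k - b i k) (λ k → x k j - x′ k j) ≈ 0#
  difference-kernel a b a′ b′ x x′ eq eq′ i j =
    +-cancelˡ (dot z (col x′ j)) _ _ (begin
      dot z (col x′ j) + dot z (λ k → x k j - x′ k j)
        ≈⟨ dot-+ʳ z (col x′ j) _ ⟨
      dot z (λ k → x′ k j + (x k j - x′ k j))
        ≈⟨ dot-cong (λ _ → refl) (λ k → y+[x-y]≈x (x k j) (x′ k j)) ⟩
      dot z (col x j)
        ≈⟨ +-cancelˡ (a′ i j) _ _ (trans (sym (a≈a′+zy x eq)) (a≈a′+zy x′ eq′)) ⟩
      dot z (col x′ j)
        ≈⟨ +-identityʳ _ ⟨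
      dot z (col x′ j) + 0# ∎)
    where
    z : Vector Carrier _
    z k = b′ i k - b i k

    -- Here b′ is split as b + z, and the common term b y is cancelled.
    a≈a′+zy : ∀ y → f a b y ≈M f a′ b′ y → a i j ≈ a′ i j + dot z (col y j)
    a≈a′+zy y eq = +-cancelʳ (dot (b i) (col y j)) _ _ (begin
      a i j + dot (b i) (col y j)
        ≈⟨ +-congˡ (*M≈dot b y i j) ⟨
      f a b y i j
        ≈⟨ eq i j ⟩
      f a′ b′ y i j
        ≈⟨ +-congˡ (*M≈dot b′ y i j) ⟩
      a′ i j + dot (b′ i) (col y j)
        ≈⟨ +-congˡ (dot-cong (λ k → y+[x-y]≈x (b′ i k) (b i k)) (λ _ → refl)) ⟨
      a′ i j + dot (λ k → b i k + z k) (col y j)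
        ≈⟨ +-congˡ (dot-+ˡ (b i) z (col y j)) ⟩
      a′ i j + (dot (b i) (col y j) + dot z (col y j))
        ≈⟨ +-congˡ (+-comm _ _) ⟩
      a′ i j + (dot z (col y j) + dot (b i) (col y j))
        ≈⟨ +-assoc _ _ _ ⟨
      a′ i j + dot z (col y j) + dot (b i) (col y j) ∎)

  -- The matrix killing the vector with j-th entry 1 and other entries w, whose other columns are m.
  withKernel : ∀ {k} → Fin (suc k) × Vector Carrier k → Vector (Vector Carrier k) (suc k) → Mat (suc k)
  withKernel (j , w) m i = insertAt (m i) j (- dot (m i) w)

  -- With n = k + 1 there are n coordinates, q^k normalised kernel vectors and q^(k n) choices of
  -- the remaining columns. A matrix may be listed several times, which is harmless for an upper
  -- bound on the number of singular matrices.
  singular : ∀ k → List (Mat (suc k))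
  singular k = cartesianProductWith withKernel
    (cartesianProduct (allFin (suc k)) (vectors elements k)) (matrices (suc k) k)

  length-singular : ∀ k → length (singular k) ≡ suc k ℕ.* q ^ k ℕ.* (q ^ k) ^ suc k
  length-singular k = ≡.trans (length-cartesianProductWith withKernel
      (cartesianProduct (allFin (suc k)) (vectors elements k)) (matrices (suc k) k))
    (cong₂ ℕ._*_ (≡.trans (length-cartesianProductWith _,_ (allFin (suc k)) (vectors elements k))
        (cong₂ ℕ._*_ (length-tabulate {n = suc k} id)
          (≡.trans (length-vectors elements k) (cong (_^ k) length-elements))))
      (length-matrices (suc k) k))

  withKernel-∈-singular : ∀ {k} j w m → _∈_ (MatSetoid (suc k)) (withKernel (j , w) m) (singular k)
  withKernel-∈-singular {k} j w m =
    Membership.∈-cartesianProductWith⁺ (×-setoid (≡.setoid (Fin (suc k))) (≋-setoid setoid k))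
      (≋-setoid (≋-setoid setoid k) (suc k)) (MatSetoid (suc k))
      (λ { {j , _} (≡.refl , w≋) m≋ i →
           insertAt-cong setoid j (m≋ i) (-‿cong (dot-cong (m≋ i) w≋)) })
      (Membership.∈-cartesianProductWith⁺ (≡.setoid _) (≋-setoid setoid k)
        (×-setoid (≡.setoid (Fin (suc k))) (≋-setoid setoid k)) _,_
        (Membership.∈-tabulate⁺ (≡.setoid _) {f = id} j) (∈-vectors setoid ∈-elements k w))
      (∈-vectors (≋-setoid setoid k) (∈-vectors setoid ∈-elements k) (suc k) m)

  -- Dividing `v` by its nonzero coordinate `v j` keeps it in the kernel and makes that entry 1, so
  -- column `j` of `z` is minus the combination of the other columns with coefficients `w`.
  kernel⇒∈-singular : ∀ {k} (z : Mat (suc k)) (v : Vector Carrier (suc k)) j → ¬ (v j ≈ 0#) →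
                      (∀ i → dot (z i) v ≈ 0#) → _∈_ (MatSetoid (suc k)) z (singular k)
  kernel⇒∈-singular z v j vj≉0 zv≈0 =
    Membership.∈-resp-≈ (MatSetoid _) (λ i l → sym (trans
      (reflexive (≡.sym (insertAt-removeAt (z i) j l)))
      (insertAt-cong setoid j (λ _ → refl) (column i) l)))
      (withKernel-∈-singular j w (λ i → removeAt (z i) j))
    where
    u = proj₁ (inverse (v j) vj≉0)
    vju≈1 = proj₂ (inverse (v j) vj≉0)

    w : Vector Carrier _
    w l = removeAt v j l * u

    column : ∀ i → z i j ≈ - dot (removeAt (z i) j) w
    column i = +-inverseˡ-unique _ _ (begin
      z i j + dot (removeAt (z i) j) w
        ≈⟨ +-cong (trans (*-congˡ vju≈1) (*-identityʳ _)) 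
             (sym (dot-*ʳ (removeAt (z i) j) (removeAt v j) u)) ⟨
      z i j * (v j * u) + dot (removeAt (z i) j) (removeAt v j) * u
        ≈⟨ +-congʳ (*-assoc _ _ u) ⟨
      z i j * v j * u + dot (removeAt (z i) j) (removeAt v j) * u
        ≈⟨ distribʳ u _ _ ⟨
      (z i j * v j + dot (removeAt (z i) j) (removeAt v j)) * u
        ≈⟨ *-congʳ (sum-remove {i = j} λ l → z i l * v l) ⟨
      dot (z i) v * u
        ≈⟨ *-congʳ (zv≈0 i) ⟩
      0# * u
        ≈⟨ zeroˡ u ⟩
      0# ∎)

  order-nonZero : ℕ.NonZero q
  order-nonZero = Fin.nonZeroIndex (from 0#)

  matrices-nonZero : ∀ m n → ℕ.NonZero (length (matrices m n))
  matrices-nonZero m n = ≡.subst ℕ.NonZero (≡.sym (length-matrices m n))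
    (ℕ.m^n≢0 (q ^ n) m {{ℕ.m^n≢0 q n {{order-nonZero}}}})

  -- Some entry (i , j) of x - x′ is nonzero, so its column j is a kernel vector of b′ - b with
  -- nonzero coordinate i. Writing the conclusion as b + z = b′ lets each z, for given b, account
  -- for at most one slope b′.
  singular-difference : ∀ {k} (a b a′ b′ x x′ : Mat (suc k)) →
    f a b x ≈M f a′ b′ x → f a b x′ ≈M f a′ b′ x′ → ¬ (x ≈M x′) →
    Any (λ z → (b +M z) ≈M b′) (singular k)
  singular-difference a b a′ b′ x x′ eq eq′ x≉x′ =
    -- Decidable equality extracts a differing row, then a differing entry, from the negated
    -- equality.
    let i , row≉ = ¬∀⟶∃¬ _ _ (λ i → all? λ j → x i j ≟ x′ i j) x≉x′
        j , entry≉ = ¬∀⟶∃¬ _ _ (λ j → x i j ≟ x′ i j) row≉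
    in Any.map (λ z≈ i j → trans (+-congˡ (sym (z≈ i j))) (y+[x-y]≈x (b′ i j) (b i j)))
         (kernel⇒∈-singular (λ i k → b′ i k - b i k) (λ k → x k j - x′ k j) i
           (entry≉ ∘ x∙y⁻¹≈ε⇒x≈y _ _)
           (λ i → difference-kernel a b a′ b′ x x′ eq eq′ i j))
    where open DecSetoid fieldDecSetoid using (_≟_)

-- Counting incidences

open import Data.Integer as ℤ using ()
import Data.Integer.Properties as ℤ
open import Data.List.Membership.Propositional using (find)
open import Data.List.Membership.Propositional.Properties using (∈-cartesianProduct⁻)
open import Data.List.Properties using (map-∘; map-++)
open import Data.List.Relation.Unary.All as All using (All)
open import Data.List.Relation.Unary.All.Properties using (all-filter)
open import Data.List.Relation.Unary.Any using (any?)
open import Data.Nat using (_≤_; _*_; _∸_; _+_; _<_; z≤n; s≤s; _≤?_; NonZero; >-nonZero; >-nonZero⁻¹)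
open import Data.Nat.ListAction using (sum)
open import Data.Nat.ListAction.Properties using (sum-++)
open import Data.Nat.Properties hiding (_≟_; _≤?_)
open import Data.Nat.Solver using (module +-*-Solver)
open import Data.Sum using ([_,_]′)
open import Data.Rational as ℚ using (½)
open import Data.Rational using (ℚ; 0ℚ) renaming (_<_ to _<ℚ_; _≤_ to _≤ℚ_; _*_ to _*ℚ_)
import Data.Rational.Properties as ℚ
import Data.Rational.Unnormalised as ℚᵘ
import Data.Rational.Unnormalised.Properties as ℚᵘ
open import Relation.Binary.PropositionalEquality using (refl; sym; trans; module ≡-Reasoning)
open import Relation.Nullary using (Dec; yes; no; contradiction)
open import Relation.Nullary.Decidable using (¬?; decidable-stable)
open import Relation.Unary using (Pred; Decidable)
open +-*-Solver using (solve; _:=_; _:+_; _:*_; con)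

private variable
  X Y : Set
  p : Level

-- Finite sums over lists and counting by indicators

∑ : List X → (X → ℕ) → ℕ
∑ xs g = sum (map g xs)

infix 5 ∑
syntax ∑ xs (λ x → e) = ∑[ x ∈ xs ] e

∑-mono : (xs : List X) {g h : X → ℕ} → (∀ x → g x ≤ h x) → ∑ xs g ≤ ∑ xs h
∑-mono []       g≤h = z≤n
∑-mono (x ∷ xs) g≤h = +-mono-≤ (g≤h x) (∑-mono xs g≤h)

∑-cong : (xs : List X) {g h : X → ℕ} → (∀ x → g x ≡ h x) → ∑ xs g ≡ ∑ xs h
∑-cong []       g≡h = refl
∑-cong (x ∷ xs) g≡h = cong₂ _+_ (g≡h x) (∑-cong xs g≡h)

∑-const : (xs : List X) (k : ℕ) → ∑ xs (λ _ → k) ≡ length xs * k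
∑-const []       k = refl
∑-const (x ∷ xs) k = cong (k +_) (∑-const xs k)

∑-distrib-+ : (xs : List X) (g h : X → ℕ) → ∑[ x ∈ xs ] (g x + h x) ≡ ∑ xs g + ∑ xs h
∑-distrib-+ []       g h = refl
∑-distrib-+ (x ∷ xs) g h = trans (cong (g x + h x +_) (∑-distrib-+ xs g h))
  (solve 4 (λ a b c d → (a :+ b) :+ (c :+ d) := (a :+ c) :+ (b :+ d)) refl
    (g x) (h x) (∑ xs g) (∑ xs h))

*-distribˡ-∑ : (k : ℕ) (xs : List X) (g : X → ℕ) → k * ∑ xs g ≡ ∑[ x ∈ xs ] (k * g x)
*-distribˡ-∑ k []       g = *-zeroʳ k
*-distribˡ-∑ k (x ∷ xs) g =
  trans (*-distribˡ-+ k (g x) (∑ xs g)) (cong (k * g x +_) (*-distribˡ-∑ k xs g))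

*-distribʳ-∑ : (k : ℕ) (xs : List X) (g : X → ℕ) → ∑ xs g * k ≡ ∑[ x ∈ xs ] (g x * k)
*-distribʳ-∑ k []       g = refl
*-distribʳ-∑ k (x ∷ xs) g =
  trans (*-distribʳ-+ k (g x) (∑ xs g)) (cong (g x * k +_) (*-distribʳ-∑ k xs g))

∑-comm : (xs : List X) (ys : List Y) (g : X → Y → ℕ) →
         ∑[ x ∈ xs ] ∑[ y ∈ ys ] g x y ≡ ∑[ y ∈ ys ] ∑[ x ∈ xs ] g x y
∑-comm []       ys g = sym (trans (∑-const ys 0) (*-zeroʳ (length ys)))
∑-comm (x ∷ xs) ys g = trans (cong (∑ ys (g x) +_) (∑-comm xs ys g))
  (sym (∑-distrib-+ ys (g x) (λ y → ∑[ x ∈ xs ] g x y)))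

∑-*-∑ : (xs : List X) (ys : List Y) (g : X → ℕ) (h : Y → ℕ) →
        ∑ xs g * ∑ ys h ≡ ∑[ x ∈ xs ] ∑[ y ∈ ys ] (g x * h y)
∑-*-∑ xs ys g h = trans (*-distribʳ-∑ (∑ ys h) xs g) (∑-cong xs λ x → *-distribˡ-∑ (g x) ys h)

∑-cartesianProduct : (xs : List X) (ys : List Y) (g : X × Y → ℕ) →
                     ∑ (cartesianProduct xs ys) g ≡ ∑[ x ∈ xs ] ∑[ y ∈ ys ] g (x , y)
∑-cartesianProduct []       ys g = refl
∑-cartesianProduct (x ∷ xs) ys g = begin
  sum (map g (map (x ,_) ys ++ cartesianProduct xs ys))
    ≡⟨ cong sum (map-++ g (map (x ,_) ys) _) ⟩
  sum (map g (map (x ,_) ys) ++ map g (cartesianProduct xs ys))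
    ≡⟨ sum-++ (map g (map (x ,_) ys)) _ ⟩
  ∑ (map (x ,_) ys) g + ∑ (cartesianProduct xs ys) g
    ≡⟨ cong₂ _+_ (cong sum (sym (map-∘ ys))) (∑-cartesianProduct xs ys g) ⟩
  (∑[ y ∈ ys ] g (x , y)) + (∑[ x ∈ xs ] ∑[ y ∈ ys ] g (x , y)) ∎
  where open ≡-Reasoning

⟦_⟧ : {P : Set p} → Dec P → ℕ
⟦ yes _ ⟧ = 1
⟦ no  _ ⟧ = 0

module _ {P : Pred X p} (P? : Decidable P) where

  ∑-any : {xs : List X} → Any P xs → 1 ≤ ∑[ x ∈ xs ] ⟦ P? x ⟧
  ∑-any {x ∷ xs} (here px) with P? x
  ... | yes _  = s≤s z≤n
  ... | no ¬px = contradiction px ¬px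
  ∑-any {x ∷ xs} (there pxs) = ≤-trans (∑-any pxs) (m≤n+m _ ⟦ P? x ⟧)

  ∑-none : {xs : List X} → ¬ Any P xs → ∑[ x ∈ xs ] ⟦ P? x ⟧ ≡ 0
  ∑-none {[]}     ¬p = refl
  ∑-none {x ∷ xs} ¬p with P? x
  ... | yes px = contradiction (here px) ¬p
  ... | no _   = ∑-none (¬p ∘ there)

  length-filter+∑-¬ : (xs : List X) →
    length (filter P? xs) + (∑[ x ∈ xs ] ⟦ ¬? (P? x) ⟧) ≡ length xs
  length-filter+∑-¬ []       = refl
  length-filter+∑-¬ (x ∷ xs) with P? x
  ... | yes _ = cong suc (length-filter+∑-¬ xs)
  ... | no  _ = trans (+-suc _ _) (cong suc (length-filter+∑-¬ xs))

-- With the larger number written as m + d, the two sides differ by d². Ordering the arguments first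
-- avoids truncated subtraction.
2*m*n≤m²+n² : ∀ m n → 2 * (m * n) ≤ m * m + n * n
2*m*n≤m²+n² m n = [ ordered , (λ n≤m → subst₂ _≤_ (cong (2 *_) (*-comm n m))
                                (+-comm (n * n) (m * m)) (ordered n≤m)) ]′ (≤-total m n)
  where
  ordered : ∀ {m n} → m ≤ n → 2 * (m * n) ≤ m * m + n * n
  ordered {m} m≤n with m≤n⇒∃[o]m+o≡n m≤n
  ... | d , refl = subst (2 * (m * (m + d)) ≤_)
    (solve 2 (λ m d → con 2 :* (m :* (m :+ d)) :+ d :* d := m :* m :+ (m :+ d) :* (m :+ d)) refl m d)
    (m≤m+n _ (d * d))

module Counting (S : DecSetoid 0ℓ 0ℓ) where
  open DecSetoid S using (Carrier; _≈_; _≟_; setoid) renaming (sym to ≈-sym; trans to ≈-trans)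

  -- Every "at most one" bound below comes from here: after one entry satisfies `P`, a second would
  -- equal it and contradict distinctness.
  ∑-unique : {P : Pred Carrier p} (P? : Decidable P) → (∀ {x y} → P x → P y → x ≈ y) →
             ∀ {xs} → Unique setoid xs → ∑[ x ∈ xs ] ⟦ P? x ⟧ ≤ 1
  ∑-unique P? P! {[]}     []         = z≤n
  ∑-unique P? P! {x ∷ xs} (x∉ ∷ xs!) with P? x
  ... | no  _  = ∑-unique P? P! xs!
  ... | yes px = s≤s (≤-reflexive (∑-none P? (unmatched x∉)))
    where
    unmatched : ∀ {ys} → All (λ y → ¬ x ≈ y) ys → ¬ Any _ ys
    unmatched (x≉y ∷ _) (here py)   = x≉y (P! px py)
    unmatched (_ ∷ x∉)  (there pys) = unmatched x∉ pys

-- The lines ℓ ∈ lines are the graphs {(x , eval ℓ x)}.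
module Incidence
  (S : DecSetoid 0ℓ 0ℓ)
  (univ : List (DecSetoid.Carrier S)) (univ! : Unique (DecSetoid.setoid S) univ)
  (∈-univ : ∀ x → _∈_ (DecSetoid.setoid S) x univ)
  {Line : Set} (eval : Line → DecSetoid.Carrier S → DecSetoid.Carrier S)
  (eval-cong : ∀ ℓ {x y} → DecSetoid._≈_ S x y → DecSetoid._≈_ S (eval ℓ x) (eval ℓ y))
  (lines : List Line)
  where
  open DecSetoid S using (Carrier; _≈_; _≟_; setoid) renaming (sym to ≈-sym; trans to ≈-trans)
  open Counting S

  private
    T = length lines
    Q = length univ

  linesThrough : Carrier → Carrier → ℕ
  linesThrough x y = ∑[ ℓ ∈ lines ] ⟦ eval ℓ x ≟ y ⟧

  commonPoints : Line → Line → ℕ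
  commonPoints ℓ ℓ′ = ∑[ x ∈ univ ] ⟦ eval ℓ x ≟ eval ℓ′ x ⟧

  -- Each line has a point above every x, namely `eval ℓ x`, and that value occurs in `univ`.
  firstMoment : T * Q ≤ ∑[ x ∈ univ ] ∑[ y ∈ univ ] linesThrough x y
  firstMoment = begin
    T * Q
      ≡⟨ *-comm T Q ⟩
    Q * T
      ≡⟨ ∑-const univ T ⟨
    ∑[ x ∈ univ ] T
      ≡⟨ ∑-cong univ (λ x → trans (∑-const lines 1) (*-identityʳ T)) ⟨
    ∑[ x ∈ univ ] ∑[ ℓ ∈ lines ] 1
      ≤⟨ ∑-mono univ (λ x → ∑-mono lines λ ℓ → ∑-any (eval ℓ x ≟_) (∈-univ (eval ℓ x))) ⟩
    ∑[ x ∈ univ ] ∑[ ℓ ∈ lines ] ∑[ y ∈ univ ] ⟦ eval ℓ x ≟ y ⟧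
      ≡⟨ ∑-cong univ (λ x → ∑-comm lines univ _) ⟩
    ∑[ x ∈ univ ] ∑[ y ∈ univ ] linesThrough x y ∎
    where open ≤-Reasoning

  -- The square at (x , y) counts ordered pairs of lines through that point; exchanging sums
  -- regroups the count by pairs of lines.
  secondMoment : ∑[ x ∈ univ ] ∑[ y ∈ univ ] (linesThrough x y * linesThrough x y)
                 ≤ ∑[ ℓ ∈ lines ] ∑[ ℓ′ ∈ lines ] commonPoints ℓ ℓ′
  secondMoment = begin
    ∑[ x ∈ univ ] ∑[ y ∈ univ ] (linesThrough x y * linesThrough x y)
      ≡⟨ ∑-cong univ (λ x → ∑-cong univ λ y → ∑-*-∑ lines lines _ _) ⟩
    ∑[ x ∈ univ ] ∑[ y ∈ univ ] ∑[ ℓ ∈ lines ] ∑[ ℓ′ ∈ lines ] both x y ℓ ℓ′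
      ≡⟨ ∑-cong univ (λ x → ∑-comm univ lines _) ⟩
    ∑[ x ∈ univ ] ∑[ ℓ ∈ lines ] ∑[ y ∈ univ ] ∑[ ℓ′ ∈ lines ] both x y ℓ ℓ′
      ≡⟨ ∑-comm univ lines _ ⟩
    ∑[ ℓ ∈ lines ] ∑[ x ∈ univ ] ∑[ y ∈ univ ] ∑[ ℓ′ ∈ lines ] both x y ℓ ℓ′
      ≡⟨ ∑-cong lines (λ ℓ → ∑-cong univ λ x → ∑-comm univ lines _) ⟩
    ∑[ ℓ ∈ lines ] ∑[ x ∈ univ ] ∑[ ℓ′ ∈ lines ] ∑[ y ∈ univ ] both x y ℓ ℓ′
      ≡⟨ ∑-cong lines (λ ℓ → ∑-comm univ lines _) ⟩
    ∑[ ℓ ∈ lines ] ∑[ ℓ′ ∈ lines ] ∑[ x ∈ univ ] ∑[ y ∈ univ ] both x y ℓ ℓ′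
      ≤⟨ ∑-mono lines (λ ℓ → ∑-mono lines λ ℓ′ → ∑-mono univ λ x → meet (eval ℓ x) (eval ℓ′ x)) ⟩
    ∑[ ℓ ∈ lines ] ∑[ ℓ′ ∈ lines ] commonPoints ℓ ℓ′ ∎
    where
    open ≤-Reasoning
    both : Carrier → Carrier → Line → Line → ℕ
    both x y ℓ ℓ′ = ⟦ eval ℓ x ≟ y ⟧ * ⟦ eval ℓ′ x ≟ y ⟧

    -- Above a fixed x two lines share a point only when their values agree, and then that point is
    -- unique.
    meet : ∀ u v → ∑[ y ∈ univ ] (⟦ u ≟ y ⟧ * ⟦ v ≟ y ⟧) ≤ ⟦ u ≟ v ⟧
    meet u v with u ≟ v
    ... | yes _ = ≤-trans (∑-mono univ product≤)
                    (∑-unique (u ≟_) (λ u≈x u≈y → ≈-trans (≈-sym u≈x) u≈y) univ!)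
      where
      product≤ : ∀ y → ⟦ u ≟ y ⟧ * ⟦ v ≟ y ⟧ ≤ ⟦ u ≟ y ⟧
      product≤ y with v ≟ y
      ... | yes _ = ≤-reflexive (*-identityʳ _)
      ... | no  _ = subst (_≤ ⟦ u ≟ y ⟧) (sym (*-zeroʳ ⟦ u ≟ y ⟧)) z≤n
    ... | no u≉v = ≤-reflexive
      (trans (∑-cong univ disjoint) (trans (∑-const univ 0) (*-zeroʳ Q)))
      where
      disjoint : ∀ y → ⟦ u ≟ y ⟧ * ⟦ v ≟ y ⟧ ≡ 0
      disjoint y with u ≟ y | v ≟ y
      ... | yes u≈y | yes v≈y = contradiction (≈-trans u≈y (≈-sym v≈y)) u≉v
      ... | yes _   | no _    = refl
      ... | no _    | _       = refl

  -- The image and the values it misses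

  module Image (pts : List Carrier) (pts! : Unique setoid pts) where

    Hit : Carrier → Set
    Hit y = Any (λ ℓ → Any (λ c → eval ℓ c ≈ y) pts) lines

    hit? : Decidable Hit
    hit? y = any? (λ ℓ → any? (λ c → eval ℓ c ≟ y) pts) lines

    -- Filtering `univ` makes the list duplicate-free and lets its complement be counted by
    -- `misses`.
    image : List Carrier
    image = filter hit? univ

    private
      misses : ℕ
      misses = ∑[ y ∈ univ ] ⟦ ¬? (hit? y) ⟧

      -- This is the indicator function of `pts` up to `_≈_`, since `pts` has no repetitions.
      occurrences : Carrier → ℕ
      occurrences x = ∑[ c ∈ pts ] ⟦ c ≟ x ⟧

      -- AM-GM
      unweighted : ∀ r {h} → h ≡ 0 → 2 * (Q * T) * r + T * T * h ≤ Q * Q * (r * r) + T * T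
      unweighted r refl = subst₂ _≤_
        (solve 3 (λ q t r → con 2 :* (q :* r :* t) := con 2 :* (q :* t) :* r :+ t :* t :* con 0)
          refl Q T r)
        (solve 3 (λ q t r → q :* r :* (q :* r) :+ t :* t := q :* q :* (r :* r) :+ t :* t)
          refl Q T r)
        (2*m*n≤m²+n² (Q * r) T)

      unmet : ∀ {r h} → r ≡ 0 → h ≤ 1 → 2 * (Q * T) * r + T * T * h ≤ Q * Q * (r * r) + T * T
      unmet {h = h} refl h≤1 = begin
        2 * (Q * T) * 0 + T * T * h ≡⟨ cong (_+ T * T * h) (*-zeroʳ (2 * (Q * T))) ⟩
        T * T * h                   ≤⟨ *-monoʳ-≤ (T * T) h≤1 ⟩
        T * T * 1                   ≡⟨ *-identityʳ (T * T) ⟩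
        T * T                       ≤⟨ m≤n+m (T * T) _ ⟩
        Q * Q * 0 + T * T           ∎
        where open ≤-Reasoning

      -- This is T² h ≤ (Q r - T)² with the cross term moved to the left, so that no subtraction in
      -- ℕ occurs. Here r is the number of lines through (x , y), with mean T / Q, and h is the
      -- indicator of the pairs of a point of `pts` and a missed value, where r vanishes.
      pointwise : ∀ x y →
        2 * (Q * T) * linesThrough x y + T * T * (occurrences x * ⟦ ¬? (hit? y) ⟧)
        ≤ Q * Q * (linesThrough x y * linesThrough x y) + T * T
      pointwise x y with hit? y
      ... | yes _ = unweighted (linesThrough x y) (*-zeroʳ (occurrences x))
      ... | no ¬hit with any? (_≟ x) pts
      ...   | no x∉pts = unweighted (linesThrough x y)
                           (trans (*-identityʳ _) (∑-none (_≟ x) x∉pts))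
      -- As x lies in `pts`, a line through (x , y) would make y a hit.
      ...   | yes x∈pts = unmet (∑-none (λ ℓ → eval ℓ x ≟ y) (¬hit ∘ Any.map hitAt))
                            (subst (_≤ 1) (sym (*-identityʳ _))
                              (∑-unique (_≟ x) (λ c≈x c′≈x → ≈-trans c≈x (≈-sym c′≈x)) pts!))
        where
        hitAt : ∀ {ℓ} → eval ℓ x ≈ y → Any (λ c → eval ℓ c ≈ y) pts
        hitAt {ℓ} ℓx≈y = Any.map (λ c≈x → ≈-trans (eval-cong ℓ c≈x) ℓx≈y) x∈pts

      -- Each `c` in `pts` is found in `univ`, so the occurrences add up to at least `length pts`.
      weight≥ : length pts * misses ≤
                ∑[ x ∈ univ ] ∑[ y ∈ univ ] (occurrences x * ⟦ ¬? (hit? y) ⟧)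
      weight≥ = begin
        length pts * misses
          ≡⟨ cong (_* misses) (trans (∑-const pts 1) (*-identityʳ (length pts))) ⟨
        (∑[ c ∈ pts ] 1) * misses
          ≤⟨ *-monoˡ-≤ misses (∑-mono pts λ c → ∑-any (c ≟_) (∈-univ c)) ⟩
        (∑[ c ∈ pts ] ∑[ x ∈ univ ] ⟦ c ≟ x ⟧) * misses
          ≡⟨ cong (_* misses) (∑-comm pts univ _) ⟩
        ∑ univ occurrences * misses
          ≡⟨ ∑-*-∑ univ univ _ _ ⟩
        ∑[ x ∈ univ ] ∑[ y ∈ univ ] (occurrences x * ⟦ ¬? (hit? y) ⟧) ∎
        where open ≤-Reasoning

    -- Sum the pointwise inequality over all points (x , y): this is Chebyshev's inequality.
    misses-bound : ∀ B → ∑[ ℓ ∈ lines ] ∑[ ℓ′ ∈ lines ] commonPoints ℓ ℓ′ ≤ T * T + B →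
                   T * T * (length pts * misses) ≤ Q * Q * B
    -- The cross term 2 T² Q² is put on both sides. On the right, the second moment and the constant
    -- term supply T² Q² each, so only the excess `B` survives the cancellation.
    misses-bound B few = +-cancelˡ-≤ (2 * (Q * T) * (T * Q)) _ _ (begin
      2 * (Q * T) * (T * Q) + T * T * (length pts * misses)
        ≤⟨ +-mono-≤ (*-monoʳ-≤ (2 * (Q * T)) firstMoment) (*-monoʳ-≤ (T * T) weight≥) ⟩
      2 * (Q * T) * ∑∑ linesThrough + T * T * ∑∑ weight
        ≡⟨ ∑∑-linear (2 * (Q * T)) (T * T) linesThrough weight ⟨
      ∑∑ (λ x y → 2 * (Q * T) * linesThrough x y + T * T * weight x y)
        ≤⟨ ∑-mono univ (λ x → ∑-mono univ (pointwise x)) ⟩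
      ∑∑ (λ x y → Q * Q * (linesThrough x y * linesThrough x y) + T * T)
        ≡⟨ ∑-cong univ (λ x → ∑-cong univ λ y →
             cong (Q * Q * (linesThrough x y * linesThrough x y) +_) (*-identityʳ (T * T))) ⟨
      ∑∑ (λ x y → Q * Q * (linesThrough x y * linesThrough x y) + T * T * 1)
        ≡⟨ ∑∑-linear (Q * Q) (T * T) _ (λ _ _ → 1) ⟩
      Q * Q * ∑∑ (λ x y → linesThrough x y * linesThrough x y) + T * T * ∑∑ (λ _ _ → 1)
        ≤⟨ +-mono-≤ (*-monoʳ-≤ (Q * Q) (≤-trans secondMoment few))
             (≤-reflexive (cong (T * T *_) (trans (∑-const univ _) (cong (Q *_) (∑-const univ 1))))) ⟩
      Q * Q * (T * T + B) + T * T * (Q * (Q * 1))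
        ≡⟨ solve 3 (λ q t b → q :* q :* (t :* t :+ b) :+ t :* t :* (q :* (q :* con 1))
                     := con 2 :* (q :* t) :* (t :* q) :+ q :* q :* b) refl Q T B ⟩
      2 * (Q * T) * (T * Q) + Q * Q * B ∎)
      where
      open ≤-Reasoning
      ∑∑ : (Carrier → Carrier → ℕ) → ℕ
      ∑∑ g = ∑[ x ∈ univ ] ∑[ y ∈ univ ] g x y

      weight : Carrier → Carrier → ℕ
      weight x y = occurrences x * ⟦ ¬? (hit? y) ⟧

      ∑∑-linear : ∀ j k g h → ∑∑ (λ x y → j * g x y + k * h x y) ≡ j * ∑∑ g + k * ∑∑ h
      ∑∑-linear j k g h = trans (∑-cong univ λ x → trans (∑-distrib-+ univ _ _)
          (cong₂ _+_ (sym (*-distribˡ-∑ j univ (g x))) (sym (*-distribˡ-∑ k univ (h x)))))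
        (trans (∑-distrib-+ univ _ _)
          (cong₂ _+_ (sym (*-distribˡ-∑ j univ _)) (sym (*-distribˡ-∑ k univ _))))

    image+misses : length image + misses ≡ Q
    image+misses = length-filter+∑-¬ hit? univ

    -- An image below Q / 2 leaves at least Q / 2 misses, and `misses-bound` then contradicts
    -- `many`.
    half-image : ∀ B → ∑[ ℓ ∈ lines ] ∑[ ℓ′ ∈ lines ] commonPoints ℓ ℓ′ ≤ T * T + B →
                 2 * (Q * Q * B) < T * T * (length pts * Q) → Q ≤ 2 * length image
    half-image B few many with Q ≤? 2 * length image
    ... | yes half  = half
    ... | no  ¬half = contradiction many (≤⇒≯ (begin
      T * T * (length pts * Q)
        ≤⟨ *-monoʳ-≤ (T * T) (*-monoʳ-≤ (length pts) Q≤2misses) ⟩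
      T * T * (length pts * (2 * misses))
        ≡⟨ solve 3 (λ t c m → t :* t :* (c :* (con 2 :* m)) := con 2 :* (t :* t :* (c :* m)))
             refl T (length pts) misses ⟩
      2 * (T * T * (length pts * misses))
        ≤⟨ *-monoʳ-≤ 2 (misses-bound B few) ⟩
      2 * (Q * Q * B) ∎))
      where
      open ≤-Reasoning
      Q≤2misses : Q ≤ 2 * misses
      Q≤2misses = +-cancelˡ-≤ Q _ _ (begin
        Q + Q                           ≡⟨ cong (Q +_) (+-identityʳ Q) ⟨
        2 * Q                           ≡⟨ cong (2 *_) image+misses ⟨
        2 * (length image + misses)     ≡⟨ *-distribˡ-+ 2 (length image) misses ⟩
        2 * length image + 2 * misses   ≤⟨ +-monoˡ-≤ (2 * misses) (<⇒≤ (≰⇒> ¬half)) ⟩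
        Q + 2 * misses                  ∎)

-- Transfer between rational and natural inequalities

toℚᵘ-toℚ : ∀ m → ℚ.toℚᵘ (toℚ m) ℚᵘ.≃ ℚᵘ.mkℚᵘ (ℤ.+ m) 0
toℚᵘ-toℚ m = ℚ.toℚᵘ-fromℚᵘ (ℚᵘ.mkℚᵘ (ℤ.+ m) 0)

-- Unnormalised rationals keep the denominator 1 visible, so the inequality becomes one of integers.
-- The argument 0 of `mkℚᵘ` is the denominator minus one.
toℚ-*-cancel-≤ : ∀ m n o → toℚ m ℚ.* toℚ n ℚ.≤ toℚ o → m * n ≤ o
toℚ-*-cancel-≤ m n o mn≤o = ℤ.drop‿+≤+ (subst₂ ℤ._≤_
  (trans (ℤ.*-identityʳ _) (sym (ℤ.pos-* m n))) (ℤ.*-identityʳ (ℤ.+ o)) (ℚᵘ.drop-*≤* product≤))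
  where
  open ℚᵘ.≤-Reasoning
  product≤ : ℚᵘ.mkℚᵘ (ℤ.+ m) 0 ℚᵘ.* ℚᵘ.mkℚᵘ (ℤ.+ n) 0 ℚᵘ.≤ ℚᵘ.mkℚᵘ (ℤ.+ o) 0
  product≤ = begin
    ℚᵘ.mkℚᵘ (ℤ.+ m) 0 ℚᵘ.* ℚᵘ.mkℚᵘ (ℤ.+ n) 0  ≃⟨ ℚᵘ.*-cong (toℚᵘ-toℚ m) (toℚᵘ-toℚ n) ⟨
    ℚ.toℚᵘ (toℚ m) ℚᵘ.* ℚ.toℚᵘ (toℚ n)        ≃⟨ ℚ.toℚᵘ-homo-* (toℚ m) (toℚ n) ⟨
    ℚ.toℚᵘ (toℚ m ℚ.* toℚ n)                  ≤⟨ ℚ.toℚᵘ-mono-≤ mn≤o ⟩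
    ℚ.toℚᵘ (toℚ o)                            ≃⟨ toℚᵘ-toℚ o ⟩
    ℚᵘ.mkℚᵘ (ℤ.+ o) 0                         ∎

½*toℚ-≤ : ∀ m n → m ≤ 2 * n → ½ ℚ.* toℚ m ℚ.≤ toℚ n
½*toℚ-≤ m n m≤2n = ℚ.toℚᵘ-cancel-≤ (begin
  ℚ.toℚᵘ (½ ℚ.* toℚ m)             ≃⟨ ℚ.toℚᵘ-homo-* ½ (toℚ m) ⟩
  ℚ.toℚᵘ ½ ℚᵘ.* ℚ.toℚᵘ (toℚ m)     ≃⟨ ℚᵘ.*-congˡ {ℚ.toℚᵘ ½} (toℚᵘ-toℚ m) ⟩
  ℚ.toℚᵘ ½ ℚᵘ.* ℚᵘ.mkℚᵘ (ℤ.+ m) 0  ≤⟨ ℚᵘ.*≤* (subst₂ ℤ._≤_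
                                        (sym (trans (ℤ.*-identityʳ _) (ℤ.*-identityˡ (ℤ.+ m))))
                                        (trans (cong ℤ.+_ (*-comm 2 n)) (ℤ.pos-* n 2))
                                        (ℤ.+≤+ m≤2n)) ⟩
  ℚᵘ.mkℚᵘ (ℤ.+ n) 0                ≃⟨ toℚᵘ-toℚ n ⟨
  ℚ.toℚᵘ (toℚ n)                   ∎)
  where open ℚᵘ.≤-Reasoning

-- Matrix lines and the bound on their common points

module Lines {q : ℕ} (F : FiniteField q) (k : ℕ) (A B C : Matrices.MatSet F (suc k)) where
  open Matrices F
  open FieldCounting F
  open DecSetoid (matDecSetoid (suc k)) using (_≟_)
  open Counting (matDecSetoid (suc k))

  private
    elemsA = MatSet.elems A
    elemsB = MatSet.elems B
    lines = cartesianProduct elemsA elemsB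

  evalLine : Mat (suc k) × Mat (suc k) → Mat (suc k) → Mat (suc k)
  evalLine (a , b) = f a b

  open Incidence (matDecSetoid (suc k)) (matrices (suc k) (suc k)) (matrices-unique (suc k))
    (∈-matrices (suc k)) evalLine (λ (a , b) → f-cong a b) lines
  open Image (MatSet.elems C) (MatSet.unique C)

  private
    T = length lines
    Q = length (matrices (suc k) (suc k))

  singularDifference : Mat (suc k) → Mat (suc k) → ℕ
  singularDifference b b′ = ∑[ z ∈ singular k ] ⟦ (b +M z) ≟ b′ ⟧

  -- Either b′ - b is listed in `singular k`, and the weight is at least 1, or two distinct common
  -- points would place it there, so at most one exists. Having one formula for both cases allows
  -- summation over all lines.
  commonPoints≤ : ∀ a b a′ b′ → commonPoints (a , b) (a′ , b′) ≤
                  1 + singularDifference b b′ * commonPoints (a , b) (a′ , b′)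
  commonPoints≤ a b a′ b′ with any? (λ z → (b +M z) ≟ b′) (singular k)
  ... | yes z∈ = ≤-trans (≤-trans (≤-reflexive (sym (*-identityˡ _)))
                   (*-monoˡ-≤ _ (∑-any (λ z → (b +M z) ≟ b′) z∈))) (n≤1+n _)
  ... | no z∉ = ≤-trans (∑-unique _ (λ {x} {x′} eq eq′ →
                  decidable-stable (x ≟ x′) (z∉ ∘ singular-difference a b a′ b′ x x′ eq eq′))
                  (matrices-unique (suc k))) (m≤m+n 1 _)

  ∑-commonPoints≤ : ∀ ℓ → ∑[ ℓ′ ∈ lines ] commonPoints ℓ ℓ′ ≤ T + length (singular k) * Q
  ∑-commonPoints≤ ℓ@(a , b) = begin
    ∑[ ℓ′ ∈ lines ] commonPoints ℓ ℓ′
      ≤⟨ ∑-mono lines (λ (a′ , b′) → commonPoints≤ a b a′ b′) ⟩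
    ∑[ ℓ′ ∈ lines ] (1 + sd (proj₂ ℓ′) * commonPoints ℓ ℓ′)
      ≡⟨ ∑-distrib-+ lines (λ _ → 1) _ ⟩
    (∑[ ℓ′ ∈ lines ] 1) + (∑[ ℓ′ ∈ lines ] (sd (proj₂ ℓ′) * commonPoints ℓ ℓ′))
      ≡⟨ cong₂ _+_ (trans (∑-const lines 1) (*-identityʳ T)) (∑-cartesianProduct elemsA elemsB _) ⟩
    T + (∑[ a′ ∈ elemsA ] ∑[ b′ ∈ elemsB ] (sd b′ * commonPoints ℓ (a′ , b′)))
      ≡⟨ cong (T +_) (∑-comm elemsA elemsB _) ⟩
    -- The weight depends only on the slope, so it leaves the sum over translates.
    T + (∑[ b′ ∈ elemsB ] ∑[ a′ ∈ elemsA ] (sd b′ * commonPoints ℓ (a′ , b′)))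
      ≡⟨ cong (T +_) (∑-cong elemsB λ b′ → *-distribˡ-∑ (sd b′) elemsA _) ⟨
    T + (∑[ b′ ∈ elemsB ] (sd b′ * (∑[ a′ ∈ elemsA ] commonPoints ℓ (a′ , b′))))
      ≤⟨ +-monoʳ-≤ T (∑-mono elemsB λ b′ → *-monoʳ-≤ (sd b′) (translates b′)) ⟩
    T + (∑[ b′ ∈ elemsB ] (sd b′ * Q))
      ≡⟨ cong (T +_) (*-distribʳ-∑ Q elemsB sd) ⟨
    T + ∑ elemsB sd * Q
      ≤⟨ +-monoʳ-≤ T (*-monoˡ-≤ Q differences) ⟩
    T + length (singular k) * Q ∎
    where
    open ≤-Reasoning
    module M = Setoid (MatSetoid (suc k))

    sd : Mat (suc k) → ℕ
    sd = singularDifference b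

    -- Above each x, at most one translate of slope b′ passes through the point of `ℓ`.
    translates : ∀ b′ → ∑[ a′ ∈ elemsA ] commonPoints ℓ (a′ , b′) ≤ Q
    translates b′ = begin
      ∑[ a′ ∈ elemsA ] commonPoints ℓ (a′ , b′)
        ≡⟨ ∑-comm elemsA (matrices (suc k) (suc k)) _ ⟩
      ∑[ x ∈ matrices (suc k) (suc k) ] ∑[ a′ ∈ elemsA ] ⟦ f a b x ≟ f a′ b′ x ⟧
        ≤⟨ ∑-mono (matrices (suc k) (suc k)) (λ x → ∑-unique (λ a′ → f a b x ≟ f a′ b′ x)
             (λ eq eq′ → f-cancel {b = b′} {x = x} (M.trans (M.sym eq) eq′)) (MatSet.unique A)) ⟩
      ∑[ x ∈ matrices (suc k) (suc k) ] 1
        ≡⟨ trans (∑-const (matrices (suc k) (suc k)) 1) (*-identityʳ Q) ⟩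
      Q ∎

    -- Each z carries b to the single slope b + z, so it is counted at most once.
    differences : ∑ elemsB sd ≤ length (singular k)
    differences = begin
      ∑ elemsB sd
        ≡⟨ ∑-comm elemsB (singular k) _ ⟩
      ∑[ z ∈ singular k ] ∑[ b′ ∈ elemsB ] ⟦ (b +M z) ≟ b′ ⟧
        ≤⟨ ∑-mono (singular k) (λ z → ∑-unique ((b +M z) ≟_)
             (λ eq eq′ → M.trans (M.sym eq) eq′) (MatSet.unique B)) ⟩
      ∑[ z ∈ singular k ] 1
        ≡⟨ trans (∑-const (singular k) 1) (*-identityʳ _) ⟩
      length (singular k) ∎

  ∑∑-commonPoints≤ : ∑[ ℓ ∈ lines ] ∑[ ℓ′ ∈ lines ] commonPoints ℓ ℓ′ ≤
                     T * T + T * (length (singular k) * Q)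
  ∑∑-commonPoints≤ = ≤-trans (∑-mono lines ∑-commonPoints≤)
    (≤-reflexive (trans (∑-const lines _) (*-distribˡ-+ T T _)))

  hit⇒InImage : ∀ {y} → Hit y → InImage A B C y
  hit⇒InImage hit =
    let (a , b) , ℓ∈ , hit′ = find hit
        c , c∈ , eq = find hit′
        a∈ , b∈ = ∈-cartesianProduct⁻ elemsA elemsB ℓ∈
    in a , b , c , member a∈ , member b∈ , member c∈ , M.sym eq
    where
    module M = Setoid (MatSetoid (suc k))
    member : ∀ {x xs} → Any.Any (x ≡_) xs → Any.Any (x ≈M_) xs
    member = Any.map M.reflexive

  -- Multiplying the hypothesis by T Q turns it into the condition of `half-image` with excess T S
  -- Q, the one found in `∑∑-commonPoints≤`.
  large-image : 2 * (length (singular k) * (Q * Q)) < ∣ A ∣ * ∣ B ∣ * ∣ C ∣ →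
                ImageCardGE A B C (½ ℚ.* toℚ Q)
  large-image large = image , Uniqueness.filter⁺ (MatSetoid (suc k)) hit? (matrices-unique (suc k))
    , All.map hit⇒InImage (all-filter hit? (matrices (suc k) (suc k)))
    , ½*toℚ-≤ Q (length image) (half-image (T * (length (singular k) * Q)) ∑∑-commonPoints≤ scaled)
    where
    S = length (singular k)
    c = ∣ C ∣

    large′ : 2 * (S * (Q * Q)) < T * c
    large′ = subst (λ t → 2 * (S * (Q * Q)) < t * c)
      (sym (length-cartesianProductWith _,_ elemsA elemsB)) large

    instance
      -- The product T c exceeds a natural number, so T is nonzero, and scaling by T Q stays strict.
      T≢0 : NonZero T
      T≢0 = m*n≢0⇒m≢0 T {c} {{>-nonZero (≤-<-trans z≤n large′)}}
      Q≢0 : NonZero Q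
      Q≢0 = matrices-nonZero (suc k) (suc k)
      TQ≢0 : NonZero (T * Q)
      TQ≢0 = m*n≢0 T Q

    scaled : 2 * (Q * Q * (T * (S * Q))) < T * T * (c * Q)
    scaled = subst₂ _<_
      (solve 3 (λ q t s → (t :* q) :* (con 2 :* (s :* (q :* q))) := con 2 :* (q :* q :* (t :* (s :* q))))
        refl Q T S)
      (solve 3 (λ q t c → (t :* q) :* (t :* c) := t :* t :* (c :* q)) refl Q T c)
      (*-monoʳ-< (T * Q) large′)

-- Exponents and constants

2*singular≡ : ∀ {q} (F : FiniteField q) k →
  let open FieldCounting F
      Q = length (matrices (suc k) (suc k))
  in 2 * (length (singular k) * (Q * Q)) ≡ 2 * suc k * q ^ (3 * (suc k * suc k) ∸ 1)
2*singular≡ {q} F k = begin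
  2 * (length (singular k) * (Q * Q))
    ≡⟨ cong₂ (λ s Q → 2 * (s * (Q * Q))) (length-singular k) (length-matrices (suc k) (suc k)) ⟩
  2 * (suc k * q ^ k * (q ^ k) ^ suc k * ((q ^ suc k) ^ suc k * (q ^ suc k) ^ suc k))
    ≡⟨ cong₂ (λ u v → 2 * (suc k * q ^ k * u * (v * v)))
         (^-*-assoc q k (suc k)) (^-*-assoc q (suc k) (suc k)) ⟩
  2 * (suc k * q ^ k * q ^ (k * suc k) * (q ^ N * q ^ N))
    ≡⟨ solve 4 (λ n x y z → con 2 :* (n :* x :* y :* (z :* z)) := con 2 :* n :* (x :* y :* (z :* z)))
         refl (suc k) (q ^ k) (q ^ (k * suc k)) (q ^ N) ⟩
  2 * suc k * (q ^ k * q ^ (k * suc k) * (q ^ N * q ^ N))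
    ≡⟨ cong (2 * suc k *_)
         (cong₂ _*_ (^-distribˡ-+-* q k (k * suc k)) (^-distribˡ-+-* q N N)) ⟨
  2 * suc k * (q ^ (k + k * suc k) * q ^ (N + N))
    ≡⟨ cong (2 * suc k *_) (^-distribˡ-+-* q (k + k * suc k) (N + N)) ⟨
  2 * suc k * q ^ (k + k * suc k + (N + N))
    -- `3 * N` unfolds to N + (N + (N + 0)), whose first summand is the successor of k + k (k + 1),
    -- so the subtraction of 1 computes.
    ≡⟨ cong (λ e → 2 * suc k * q ^ (k + k * suc k + (N + e))) (+-identityʳ N) ⟨
  2 * suc k * q ^ (3 * N ∸ 1) ∎
  where
  open ≡-Reasoning
  open FieldCounting F
  N = suc k * suc k
  Q = length (matrices (suc k) (suc k))

theorem1p10 : (n : ℕ) → 1 ≤ n →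
    Σ ℚ λ C₀ → Σ ℚ λ c → 0ℚ <ℚ C₀ × 0ℚ <ℚ c ×
    ((q : ℕ) → Odd q → IsPrimePower q → (F : FiniteField q) →
    let open Matrices F in
    (A B C : MatSet n) →
    (C₀ *ℚ toℚ (q ^ (3 * (n * n) ∸ 1))) ≤ℚ toℚ (∣ A ∣ * ∣ B ∣ * ∣ C ∣) →
    ImageCardGE A B C (c *ℚ toℚ (q ^ (n * n))))
theorem1p10 (suc k) _ =
  -- With n = k + 1, the choice C₀ = 2 n + 1 exceeds by one the factor in 2 S Q² = 2 n X, which
  -- makes the bound strict because X > 0. The constant ½ is the half of `half-image`.
  toℚ (suc (2 * suc k)) , ½ , ℚ.positive⁻¹ _ {{ℚ.normalize-pos (suc (2 * suc k)) 1}} , ℚ.positive⁻¹ ½ ,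
  λ q _ _ F A B C large →
    let open FieldCounting F
        open Matrices F
        open Lines F k A B C
        X = q ^ (3 * (suc k * suc k) ∸ 1)
        X>0 = >-nonZero⁻¹ X {{m^n≢0 q (3 * (suc k * suc k) ∸ 1) {{order-nonZero}}}}
        2SQ²<|A||B||C| = <-≤-trans
          (subst (_< suc (2 * suc k) * X) (sym (2*singular≡ F k)) (m<n+m (2 * suc k * X) X>0))
          (toℚ-*-cancel-≤ (suc (2 * suc k)) X _ large)
    -- The number of matrices is obtained as (q^n)^n and rewritten as q^(n n).
    in subst (λ Q → ImageCardGE A B C (½ *ℚ toℚ Q))
         (trans (length-matrices (suc k) (suc k)) (^-*-assoc q (suc k) (suc k)))
         (large-image 2SQ²<|A||B||C|)
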